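{- Let $k\ge 2$ and $n\ge 1$ be integers. The fixing number of the perfect $k$-ary tree $T_k^n$ of depth $n$ is $\operatorname{Fix}(T_k^n)=(k-1)\cdot k^{n-1}$.
   Context: All graphs are finite and simple. For $k\ge 2$, $n\ge 1$, the perfect $k$-ary tree of depth $n$, denoted $T_k^n$, is the connected acyclic graph with $k^n$ leaves in which one vertex (the root) has degree $k$ and is at distance $n$ from every leaf, and all other internal (non-leaf) vertices have degree $k+1$. A set $S\subseteq V(G)$ is a fixing set for a graph $G$ if the only automorphism of $G$ that fixes every element of $S$ is the trivial one; the fixing number $\operatorname{Fix}(G)$ is the smallest cardinality of a fixing set. -}

module Defs where

open import Data.Fin.Base using (Fin)
open import Data.Fin.Permutation using (Permutation′; _⟨$⟩ʳ_)
open import Data.Fin.Subset using (Subset; _∈_; ∣_∣)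
open import Data.List.Base using (List; []; _∷_)
open import Data.List.Relation.Unary.Unique.Propositional using (Unique)
open import Data.Nat.Base using (ℕ; zero; suc; _^_; _≤_)
open import Data.Nat.Properties using (_≟_)
open import Data.Product.Base using (Σ-syntax; ∃-syntax; _×_)
open import Data.Vec.Base using (tabulate)
open import Function.Bundles using (_⇔_)
open import Level using (0ℓ)
open import Relation.Binary.Core using (Rel)
open import Relation.Binary.Construct.Closure.ReflexiveTransitive using (Star; ε; _◅_)
open import Relation.Binary.Definitions using (Decidable; Irreflexive; Symmetric)
open import Relation.Binary.PropositionalEquality using (_≡_; _≢_)
open import Relation.Nullary.Decidable.Core using (does)
open import Relation.Nullary.Negation.Core using (¬_)

-- Finite simple graphs, with vertex set Fin order.  Decidability of
-- adjacency is what makes degrees and cardinalities computable.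
record Graph : Set₁ where
  field
    order      : ℕ
    Adj        : Rel (Fin order) 0ℓ
    adj?       : Decidable Adj
    Adj-sym    : Symmetric Adj
    Adj-irrefl : Irreflexive _≡_ Adj

  Vertex : Set
  Vertex = Fin order

  neighbours : Vertex → Subset order
  neighbours v = tabulate λ w → does (adj? v w)

  degree : Vertex → ℕ
  degree v = ∣ neighbours v ∣

  Leaf : Vertex → Set
  Leaf v = degree v ≡ 1

  leaves : Subset order
  leaves = tabulate λ v → does (degree v ≟ 1)

  Walk : Rel Vertex 0ℓ
  Walk = Star Adj

  length : ∀ {u v} → Walk u v → ℕ
  length ε       = zero
  length (_ ◅ w) = suc (length w)

  vertices : ∀ {u v} → Walk u v → List Vertex
  vertices {u} ε       = u ∷ []
  vertices {u} (_ ◅ w) = u ∷ vertices w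

  Distance : Vertex → Vertex → ℕ → Set
  Distance u v d = (Σ[ w ∈ Walk u v ] length w ≡ d) × (∀ (w : Walk u v) → d ≤ length w)

  Connected : Set
  Connected = ∀ u v → Walk u v

  -- A cycle is a path on at least three distinct vertices together with
  -- an edge joining its last vertex to its first.
  Cycle : Set
  Cycle = ∃[ u ] ∃[ v ] Σ[ w ∈ Walk u v ] Unique (vertices w) × 2 ≤ length w × Adj v u

  Acyclic : Set
  Acyclic = ¬ Cycle

  IsAutomorphism : Permutation′ order → Set
  IsAutomorphism φ = ∀ u v → Adj u v ⇔ Adj (φ ⟨$⟩ʳ u) (φ ⟨$⟩ʳ v)

  IsFixingSet : Subset order → Set
  IsFixingSet S =
    ∀ (φ : Permutation′ order) → IsAutomorphism φ →
    (∀ v → v ∈ S → φ ⟨$⟩ʳ v ≡ v) →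
    ∀ v → φ ⟨$⟩ʳ v ≡ v

  -- FixingNumber m reads "Fix(G) = m".
  FixingNumber : ℕ → Set
  FixingNumber m =
    (∃[ S ] IsFixingSet S × ∣ S ∣ ≡ m) × (∀ S → IsFixingSet S → m ≤ ∣ S ∣)

-- IsPerfectTree k n G reads "G is (a copy of) T_k^n".
record IsPerfectTree (k n : ℕ) (G : Graph) : Set where
  open Graph G
  field
    connected       : Connected
    acyclic         : Acyclic
    leaf-count      : ∣ leaves ∣ ≡ k ^ n
    root            : Vertex
    root-degree     : degree root ≡ k
    root-distance   : ∀ v → Leaf v → Distance root v n
    internal-degree : ∀ v → ¬ Leaf v → v ≢ root → degree v ≡ suc k

{-# OPTIONS --safe #-}
module Submission where

-- Every neighbour of a leaf has exactly k leaf neighbours, so the k ^ n leaves have k ^ (n ∸ 1)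
-- parents.  Two leaves with the same parent can be swapped, so a fixing set misses at most one leaf
-- below each parent.  Conversely, take all leaves but one (the heir) below each parent: an
-- automorphism fixing these fixes the parents, since k ≥ 2, hence the heirs, and then all vertices
-- by induction on height, because an inner vertex with two fixed children is fixed in an acyclic graph.

open import Algebra.Properties.CommutativeMonoid.Sum using (sum-cong-≗; sum-replicate-zero; ∑-comm)
open import Algebra.Properties.Semiring.Sum using (*-distribˡ-sum)
open import Data.Bool.Base using (Bool; true; false; if_then_else_; _∧_)
open import Data.Empty using (⊥)
open import Data.Fin.Base using (Fin; zero; suc)
open import Data.Fin.Permutation using (Permutation′; _⟨$⟩ʳ_; _⟨$⟩ˡ_; inverseˡ; inverseʳ; flip; transpose)
open import Data.Fin.Properties using (any?) renaming (_≟_ to _≟ᶠ_)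
open import Data.Fin.Subset using (Subset; inside; outside; _∈_; _∉_; ∣_∣; _∩_; ∁; ⁅_⁆; Nonempty; _⊆_)
open import Data.Fin.Subset.Properties
  using ( _∈?_; nonempty?; p⊆q⇒∣p∣≤∣q∣; p⊂q⇒∣p∣<∣q∣; ∣⁅x⁆∣≡1; x∈⁅x⁆; x∈⁅y⁆⇒x≡y; Empty-unique; ∣⊥∣≡0
        ; x∈p∩q⁺; x∈p∩q⁻; p∩q⊆p; ∣p∩q∣≤∣q∣; ⊆-antisym; x∈∁p⇒x∉p; x∉p⇒x∈∁p)
open import Data.List.Base using (List; []; _∷_; allFin)
open import Data.List.Extrema.Nat using (argmax; f[xs]≤f[argmax])
open import Data.List.Membership.DecPropositional using () renaming (_∈?_ to member?)
open import Data.List.Membership.Propositional using () renaming (_∈_ to _∈ₗ_)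
open import Data.List.Membership.Propositional.Properties using (∈-allFin)
open import Data.List.Relation.Binary.Subset.Propositional using () renaming (_⊆_ to _⊆ₗ_)
open import Data.List.Relation.Binary.Subset.Propositional.Properties using (All-resp-⊇; ∷⁺ʳ)
open import Data.List.Relation.Unary.All as All using (All; []; _∷_)
open import Data.List.Relation.Unary.All.Properties using (¬Any⇒All¬; All¬⇒¬Any)
open import Data.List.Relation.Unary.AllPairs using ([]; _∷_)
open import Data.List.Relation.Unary.Any using (here; there)
open import Data.List.Relation.Unary.Unique.Propositional using (Unique)
open import Data.Nat.Base using (ℕ; zero; suc; _+_; _*_; _∸_; _^_; _≤_; _<_; z≤n; s≤s)
open import Data.Nat.Properties
  using ( +-0-commutativeMonoid; +-*-semiring; +-mono-≤; +-monoʳ-≤; n≤1+n; +-comm; +-suc; +-identityʳ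
        ; *-identityˡ; *-identityʳ; *-zeroʳ
        ; *-cancelˡ-≡; +-cancelˡ-≡; +-cancelˡ-≤; m+[n∸m]≡n; suc-injective
        ; ≤-refl; ≤-reflexive; ≤-trans; ≤-antisym; <⇒≢; <⇒≱; n<1+n
        ; module ≤-Reasoning)
  renaming (_≟_ to _≟ⁿ_)
open import Data.Product.Base using (Σ-syntax; ∃-syntax; _×_; _,_; proj₁; proj₂)
open import Data.Sum.Base using (_⊎_; inj₁; inj₂)
open import Data.Vec.Base using ([]; _∷_; tabulate; lookup)
open import Data.Vec.Functional using (Vector)
open import Data.Vec.Properties using (lookup∘tabulate; lookup-zipWith; []=⇒lookup; lookup⇒[]=)
open import Function.Base using (_∘_; id)
open import Function.Bundles using (Equivalence; mk⇔)
open import Level using (0ℓ)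
open import Relation.Binary.Construct.Closure.ReflexiveTransitive using (ε; _◅_; _◅◅_; revApp; reverse)
open import Relation.Binary.PropositionalEquality
  using (_≡_; _≢_; refl; sym; trans; cong; subst; subst₂; ≢-sym; module ≡-Reasoning)
open import Relation.Nullary.Decidable using (Dec; yes; no; does; dec-true; _×-dec_; ¬?)
open import Relation.Nullary.Negation using (¬_; contradiction)
open import Relation.Unary using (Pred; Decidable)

open import Defs

-- Sums and cardinalities of finite subsets.

private
  variable
    m o : ℕ

sum : Vector ℕ m → ℕ
sum = Algebra.Properties.CommutativeMonoid.Sum.sum +-0-commutativeMonoid

sum-mono-≤ : (f g : Vector ℕ m) → (∀ i → f i ≤ g i) → sum f ≤ sum g
sum-mono-≤ {zero}  f g f≤g = z≤n
sum-mono-≤ {suc m} f g f≤g = +-mono-≤ (f≤g zero) (sum-mono-≤ (f ∘ suc) (g ∘ suc) (f≤g ∘ suc))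

χ : Bool → ℕ
χ b = if b then 1 else 0

∣p∣≡sum : (p : Subset m) → ∣ p ∣ ≡ sum (χ ∘ lookup p)
∣p∣≡sum []            = refl
∣p∣≡sum (inside  ∷ p) = cong suc (∣p∣≡sum p)
∣p∣≡sum (outside ∷ p) = ∣p∣≡sum p

lookup≡false⇒∉ : (p : Subset m) {x : Fin m} → lookup p x ≡ false → x ∉ p
lookup≡false⇒∉ p eq x∈p with trans (sym eq) ([]=⇒lookup x∈p)
... | ()

∣p∣≡∣p∩q∣+∣p∩∁q∣ : (p q : Subset m) → ∣ p ∣ ≡ ∣ p ∩ q ∣ + ∣ p ∩ ∁ q ∣
∣p∣≡∣p∩q∣+∣p∩∁q∣ []            []            = refl
∣p∣≡∣p∩q∣+∣p∩∁q∣ (inside  ∷ p) (inside  ∷ q) = cong suc (∣p∣≡∣p∩q∣+∣p∩∁q∣ p q)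
∣p∣≡∣p∩q∣+∣p∩∁q∣ (inside  ∷ p) (outside ∷ q) =
  trans (cong suc (∣p∣≡∣p∩q∣+∣p∩∁q∣ p q)) (sym (+-suc _ _))
∣p∣≡∣p∩q∣+∣p∩∁q∣ (outside ∷ p) (_       ∷ q) = ∣p∣≡∣p∩q∣+∣p∩∁q∣ p q

empty⇒∣p∣≡0 : {p : Subset m} → (∀ x → x ∉ p) → ∣ p ∣ ≡ 0
empty⇒∣p∣≡0 {m} x∉p = trans (cong ∣_∣ (Empty-unique λ (x , x∈p) → x∉p x x∈p)) (∣⊥∣≡0 m)

x∈p⇒1≤∣p∣ : {p : Subset m} {x : Fin m} → x ∈ p → 1 ≤ ∣ p ∣
x∈p⇒1≤∣p∣ {p = p} {x} x∈p =
  subst (_≤ ∣ p ∣) (∣⁅x⁆∣≡1 x) (p⊆q⇒∣p∣≤∣q∣ λ y∈ → subst (_∈ p) (sym (x∈⁅y⁆⇒x≡y x y∈)) x∈p)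

1≤∣p∣⇒nonempty : {p : Subset m} → 1 ≤ ∣ p ∣ → Nonempty p
1≤∣p∣⇒nonempty {p = p} 1≤∣p∣ with nonempty? p
... | yes ne = ne
... | no ¬ne = contradiction (subst (1 ≤_) (empty⇒∣p∣≡0 λ x x∈p → ¬ne (x , x∈p)) 1≤∣p∣) λ ()

subsingleton⇒∣p∣≤1 : {p : Subset m} → (∀ {x y} → x ∈ p → y ∈ p → x ≡ y) → ∣ p ∣ ≤ 1
subsingleton⇒∣p∣≤1 {p = p} unique with nonempty? p
... | yes (x , x∈p) =
  subst (∣ p ∣ ≤_) (∣⁅x⁆∣≡1 x) (p⊆q⇒∣p∣≤∣q∣ λ y∈p → subst (_∈ ⁅ x ⁆) (unique x∈p y∈p) (x∈⁅x⁆ x))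
... | no ¬ne = subst (_≤ 1) (sym (empty⇒∣p∣≡0 λ x x∈p → ¬ne (x , x∈p))) z≤n

∣p∣≤1⇒subsingleton : {p : Subset m} → ∣ p ∣ ≤ 1 → ∀ {x y} → x ∈ p → y ∈ p → x ≡ y
∣p∣≤1⇒subsingleton {p = p} ∣p∣≤1 {x} {y} x∈p y∈p with x ≟ᶠ y
... | yes x≡y = x≡y
... | no  x≢y = contradiction ∣p∣≤1 (<⇒≱ (subst (_< ∣ p ∣) (∣⁅x⁆∣≡1 x) (p⊂q⇒∣p∣<∣q∣
  ((λ z∈ → subst (_∈ p) (sym (x∈⁅y⁆⇒x≡y x z∈)) x∈p) , y , y∈p , λ y∈ → x≢y (sym (x∈⁅y⁆⇒x≡y x y∈))))))

2≤∣p∣⇒∃≢ : {p : Subset m} → 2 ≤ ∣ p ∣ → ∀ x → ∃[ y ] y ∈ p × y ≢ x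
2≤∣p∣⇒∃≢ {p = p} 2≤∣p∣ x with any? (λ y → y ∈? p ×-dec ¬? (y ≟ᶠ x))
... | yes found = found
... | no ¬found = contradiction (subsingleton⇒∣p∣≤1 λ y∈p z∈p → trans (all≡ y∈p) (sym (all≡ z∈p))) (<⇒≱ 2≤∣p∣)
  where
  all≡ : ∀ {y} → y ∈ p → y ≡ x
  all≡ {y} y∈p with y ≟ᶠ x
  ... | yes y≡x = y≡x
  ... | no  y≢x = contradiction (y , y∈p , y≢x) ¬found

module _ {P : Pred (Fin m) 0ℓ} (P? : Decidable P) where

  ∈-tabulate⁺ : ∀ {x} → P x → x ∈ tabulate (does ∘ P?)
  ∈-tabulate⁺ {x} Px = lookup⇒[]= x _ (trans (lookup∘tabulate _ x) (dec-true (P? x) Px))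

  ∈-tabulate⁻ : ∀ {x} → x ∈ tabulate (does ∘ P?) → P x
  ∈-tabulate⁻ {x} x∈ with P? x | trans (sym (lookup∘tabulate (does ∘ P?) x)) ([]=⇒lookup x∈)
  ... | yes Px | _ = Px
  ... | no  _  | ()

-- N and N′ are the two views of one incidence relation.
double-counting : (A : Subset m) (N : Fin o → Subset m) (N′ : Fin m → Subset o) →
                  (∀ i j → lookup (N i) j ≡ lookup (N′ j) i) →
                  (∀ {j} → j ∈ A → ∣ N′ j ∣ ≡ 1) →
                  ∣ A ∣ ≡ sum (λ i → ∣ A ∩ N i ∣)
double-counting {m} {o} A N N′ incidence degree≡1 = begin
  ∣ A ∣                                               ≡⟨ ∣p∣≡sum A ⟩
  sum (χ ∘ lookup A)                                  ≡⟨ sum-cong column ⟩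
  sum (λ j → sum (λ i → χ (lookup (A ∩ N i) j)))      ≡⟨ ∑-comm +-0-commutativeMonoid (λ j i → χ (lookup (A ∩ N i) j)) ⟩
  sum (λ i → sum (λ j → χ (lookup (A ∩ N i) j)))      ≡⟨ sum-cong (λ i → ∣p∣≡sum (A ∩ N i)) ⟨
  sum (λ i → ∣ A ∩ N i ∣)                             ∎
  where
  open ≡-Reasoning
  sum-cong : ∀ {l} {f g : Vector ℕ l} → (∀ i → f i ≡ g i) → sum f ≡ sum g
  sum-cong = sum-cong-≗ +-0-commutativeMonoid

  entry : ∀ i j → lookup (A ∩ N i) j ≡ lookup A j ∧ lookup (N′ j) i
  entry i j = trans (lookup-zipWith _∧_ j A (N i)) (cong (lookup A j ∧_) (incidence i j))

  column : ∀ j → χ (lookup A j) ≡ sum (λ i → χ (lookup (A ∩ N i) j))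
  -- Abstracting `entry` together with `lookup A j` lets the conjunction in its type reduce:
  -- `entries i` then equates the summand with `lookup (N′ j) i` or with `false`.
  column j with lookup A j in eq | (λ i → entry i j)
  ... | true  | entries = begin
    1                                      ≡⟨ degree≡1 (lookup⇒[]= j A eq) ⟨
    ∣ N′ j ∣                               ≡⟨ ∣p∣≡sum (N′ j) ⟩
    sum (χ ∘ lookup (N′ j))                ≡⟨ sum-cong (λ i → cong χ (entries i)) ⟨
    sum (λ i → χ (lookup (A ∩ N i) j))     ∎
  ... | false | entries = begin
    0                                      ≡⟨ sum-replicate-zero +-0-commutativeMonoid o ⟨
    sum {o} (λ _ → 0)                      ≡⟨ sum-cong (λ i → cong χ (entries i)) ⟨
    sum (λ i → χ (lookup (A ∩ N i) j))     ∎

sum-const-on : (P : Subset m) (c : ℕ) (f : Vector ℕ m) →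
               (∀ {i} → i ∈ P → f i ≡ c) → (∀ {i} → i ∉ P → f i ≡ 0) →
               sum f ≡ c * ∣ P ∣
sum-const-on P c f on off = begin
  sum f                            ≡⟨ sum-cong-≗ +-0-commutativeMonoid pointwise ⟩
  sum (λ i → c * χ (lookup P i))   ≡⟨ *-distribˡ-sum +-*-semiring c (χ ∘ lookup P) ⟨
  c * sum (χ ∘ lookup P)           ≡⟨ cong (c *_) (∣p∣≡sum P) ⟨
  c * ∣ P ∣                        ∎
  where
  open ≡-Reasoning
  pointwise : ∀ i → f i ≡ c * χ (lookup P i)
  pointwise i with lookup P i in eq
  ... | true  = trans (on (lookup⇒[]= i P eq)) (sym (*-identityʳ c))
  ... | false = trans (off (lookup≡false⇒∉ P eq)) (sym (*-zeroʳ c))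

sum≤∣p∣ : (P : Subset m) (f : Vector ℕ m) →
          (∀ i → f i ≤ 1) → (∀ {i} → i ∉ P → f i ≡ 0) → sum f ≤ ∣ P ∣
sum≤∣p∣ P f f≤1 off = subst (sum f ≤_) (sym (∣p∣≡sum P)) (sum-mono-≤ f (χ ∘ lookup P) pointwise)
  where
  pointwise : ∀ i → f i ≤ χ (lookup P i)
  pointwise i with lookup P i in eq
  ... | true  = f≤1 i
  ... | false = ≤-reflexive (off (lookup≡false⇒∉ P eq))

-- Permutations and transpositions.

permutation-injective : (φ : Permutation′ m) {x y : Fin m} → φ ⟨$⟩ʳ x ≡ φ ⟨$⟩ʳ y → x ≡ y
permutation-injective φ eq = trans (sym (inverseˡ φ)) (trans (cong (φ ⟨$⟩ˡ_) eq) (inverseˡ φ))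

module _ (i j : Fin m) where

  transpose-left : transpose i j ⟨$⟩ʳ i ≡ j
  transpose-left with i ≟ᶠ i
  ... | yes _   = refl
  ... | no  i≢i = contradiction refl i≢i

  transpose-right : transpose i j ⟨$⟩ʳ j ≡ i
  transpose-right with j ≟ᶠ i
  ... | yes j≡i = j≡i
  ... | no  _ with j ≟ᶠ j
  ...   | yes _   = refl
  ...   | no  j≢j = contradiction refl j≢j

  transpose-other : ∀ {x} → x ≢ i → x ≢ j → transpose i j ⟨$⟩ʳ x ≡ x
  transpose-other {x} x≢i x≢j with x ≟ᶠ i
  ... | yes x≡i = contradiction x≡i x≢i
  ... | no  _ with x ≟ᶠ j
  ...   | yes x≡j = contradiction x≡j x≢j
  ...   | no  _   = refl

-- Walks and paths in a graph.

module Walks (G : Graph) where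
  open Graph G

  private
    variable
      r u v w x : Vertex

  ∈-neighbours⁺ : Adj v w → w ∈ neighbours v
  ∈-neighbours⁺ {v} = ∈-tabulate⁺ (adj? v)

  ∈-neighbours⁻ : w ∈ neighbours v → Adj v w
  ∈-neighbours⁻ {v = v} = ∈-tabulate⁻ (adj? v)

  ∈-leaves⁺ : Leaf v → v ∈ leaves
  ∈-leaves⁺ = ∈-tabulate⁺ (λ v → degree v ≟ⁿ 1)

  ∈-leaves⁻ : v ∈ leaves → Leaf v
  ∈-leaves⁻ = ∈-tabulate⁻ (λ v → degree v ≟ⁿ 1)

  leaf? : Decidable Leaf
  leaf? v = degree v ≟ⁿ 1

  Adj⇒≢ : Adj v w → v ≢ w
  Adj⇒≢ e v≡w = Adj-irrefl v≡w e

  leaf-unique-neighbour : Leaf v → Adj v x → Adj v w → x ≡ w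
  leaf-unique-neighbour leaf e e′ =
    ∣p∣≤1⇒subsingleton (≤-reflexive leaf) (∈-neighbours⁺ e) (∈-neighbours⁺ e′)

  -- This supplies the incidence hypothesis of `double-counting`, with `neighbours` as both views.
  lookup-neighbours-sym : ∀ v w → lookup (neighbours v) w ≡ lookup (neighbours w) v
  lookup-neighbours-sym v w = trans (lookup∘tabulate _ w) (trans does-sym (sym (lookup∘tabulate _ v)))
    where
    does-sym : does (adj? v w) ≡ does (adj? w v)
    does-sym with adj? v w | adj? w v
    ... | yes _  | yes _   = refl
    ... | no  _  | no  _   = refl
    ... | yes e  | no  ¬e  = contradiction (Adj-sym e) ¬e
    ... | no  ¬e | yes e   = contradiction (Adj-sym e) ¬e

  start∈ : (p : Walk u v) → u ∈ₗ vertices p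
  start∈ ε       = here refl
  start∈ (_ ◅ _) = here refl

  end∈ : (p : Walk u v) → v ∈ₗ vertices p
  end∈ ε       = here refl
  end∈ (_ ◅ p) = there (end∈ p)

  module _ {P : Pred Vertex 0ℓ} where

    All-◅◅ : (p : Walk u v) {q : Walk v w} →
             All P (vertices p) → All P (vertices q) → All P (vertices (p ◅◅ q))
    All-◅◅ ε       _          qs = qs
    All-◅◅ (_ ◅ p) (Pu ∷ ps) qs = Pu ∷ All-◅◅ p ps qs

    All-revApp : (p : Walk v u) {q : Walk v w} →
                 All P (vertices p) → All P (vertices q) → All P (vertices (revApp Adj-sym p q))
    All-revApp ε       _         qs = qs
    All-revApp (_ ◅ p) (_ ∷ ps) qs = All-revApp p ps (All.lookup ps (start∈ p) ∷ qs)

    All-reverse : (p : Walk v u) → All P (vertices p) → All P (vertices (reverse Adj-sym p))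
    All-reverse p ps = All-revApp p ps (All.lookup ps (start∈ p) ∷ [])

  length-revApp : (p : Walk v u) (q : Walk v w) → length (revApp Adj-sym p q) ≡ length p + length q
  length-revApp ε       q = refl
  length-revApp (e ◅ p) q = trans (length-revApp p (Adj-sym e ◅ q)) (+-suc (length p) (length q))

  length-reverse : (p : Walk v u) → length (reverse Adj-sym p) ≡ length p
  length-reverse p = trans (length-revApp p ε) (+-identityʳ _)

  prefix : (p : Walk u v) → x ∈ₗ vertices p → Σ[ q ∈ Walk u x ] vertices q ⊆ₗ vertices p
  prefix ε       (here refl) = ε , id
  prefix (e ◅ p) (here refl) = ε , λ { (here eq) → here eq }
  prefix (e ◅ p) (there x∈p) with prefix p x∈p
  ... | q , q⊆p = e ◅ q , ∷⁺ʳ _ q⊆p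

  suffix : (p : Walk u v) → x ∈ₗ vertices p → Unique (vertices p) →
           Σ[ q ∈ Walk x v ] Unique (vertices q) × vertices q ⊆ₗ vertices p
  suffix ε       (here refl) uniq       = ε , uniq , id
  suffix (e ◅ p) (here refl) uniq       = e ◅ p , uniq , id
  suffix (e ◅ p) (there x∈p) (_ ∷ uniq) with suffix p x∈p uniq
  ... | q , q-uniq , q⊆p = q , q-uniq , there ∘ q⊆p

  _∈ₗ?_ : ∀ v (vs : List Vertex) → Dec (v ∈ₗ vs)
  _∈ₗ?_ = member? _≟ᶠ_

  -- If the start recurs on the erased tail, the walk is cut back to that occurrence. The inclusion
  -- of vertices lets a vertex avoided by `p` stay avoided by the resulting path.
  loop-erasure : (p : Walk u v) → Σ[ q ∈ Walk u v ] Unique (vertices q) × vertices q ⊆ₗ vertices p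
  loop-erasure ε = ε , [] ∷ [] , id
  loop-erasure {u} (e ◅ p) with loop-erasure p
  ... | q , uniq , q⊆p with u ∈ₗ? vertices q
  ...   | no  u∉q = e ◅ q , ¬Any⇒All¬ _ u∉q ∷ uniq , ∷⁺ʳ u q⊆p
  ...   | yes u∈q with suffix q u∈q uniq
  ...     | q′ , uniq′ , q′⊆q = q′ , uniq′ , there ∘ q⊆p ∘ q′⊆q

  -- Paths in an acyclic graph.

  module _ (acyclic : Acyclic) where

    -- A walk avoiding r between distinct neighbours of r closes, after loop erasure, to a cycle through r.
    neighbours-separated : Adj r u → Adj r v → (p : Walk u v) → All (r ≢_) (vertices p) → u ≡ v
    neighbours-separated {r} {u} {v} e e′ p r∉p with loop-erasure p
    ... | ε     , _    , _   = refl
    ... | f ◅ q , uniq , q⊆p = contradiction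
      (_ , _ , e ◅ f ◅ q , All-resp-⊇ q⊆p r∉p ∷ uniq , s≤s (s≤s z≤n) , Adj-sym e′) acyclic

    -- Following `p` and then `q` backwards joins the two second vertices without meeting `u`, so
    -- these coincide and induction applies. Only lengths are compared, since equal vertex sequences
    -- may carry different proofs of adjacency.
    path-length-unique : (p q : Walk u v) → Unique (vertices p) → Unique (vertices q) →
                         length p ≡ length q
    path-length-unique ε       ε       _          _          = refl
    path-length-unique ε       (_ ◅ q) _          (u∉q ∷ _)  = contradiction (end∈ q) (All¬⇒¬Any u∉q)
    path-length-unique (_ ◅ p) ε       (u∉p ∷ _)  _          = contradiction (end∈ p) (All¬⇒¬Any u∉p)
    path-length-unique (e ◅ p) (f ◅ q) (u∉p ∷ pu) (u∉q ∷ qu)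
      with neighbours-separated e f (p ◅◅ reverse Adj-sym q) (All-◅◅ p u∉p (All-reverse q u∉q))
    ... | refl = cong suc (path-length-unique p q pu qu)

    -- The stretch of `p` from `w` to `x` avoids `u`, so separation of neighbours applies. On a path
    -- to the root this makes the parent unique.
    neighbour-on-path : (e : Adj u w) (p : Walk w v) → Unique (vertices (e ◅ p)) →
                        Adj u x → x ∈ₗ vertices (e ◅ p) → x ≡ w
    neighbour-on-path e p _         f (here refl) = contradiction refl (Adj⇒≢ f)
    neighbour-on-path e p (u∉p ∷ _) f (there x∈p) with prefix p x∈p
    ... | q , q⊆p = sym (neighbours-separated e f q (All-resp-⊇ q⊆p u∉p))

-- The rooted structure of the perfect tree: depth, parents and children.

module PerfectTree {k n : ℕ} (2≤k : 2 ≤ k) (G : Graph) (T : IsPerfectTree k n G) where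
  open Graph G
  open IsPerfectTree T
  open Walks G

  private
    variable
      u v w ℓ p : Vertex

  root-path : ∀ v → Walk v root
  root-path v = proj₁ (loop-erasure (connected v root))

  root-path-unique : ∀ v → Unique (vertices (root-path v))
  root-path-unique v = proj₁ (proj₂ (loop-erasure (connected v root)))

  depth : Vertex → ℕ
  depth v = length (root-path v)

  depth≡length : (q : Walk v root) → Unique (vertices q) → depth v ≡ length q
  depth≡length {v} q uniq = path-length-unique acyclic (root-path v) q (root-path-unique v) uniq

  -- Contains v itself.
  ancestors : Vertex → Subset order
  ancestors v = tabulate (does ∘ (_∈ₗ? vertices (root-path v)))

  children : Vertex → Subset order
  children v = neighbours v ∩ ∁ (ancestors v)

  ∈-ancestors⁺ : u ∈ₗ vertices (root-path v) → u ∈ ancestors v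
  ∈-ancestors⁺ {v = v} = ∈-tabulate⁺ (_∈ₗ? vertices (root-path v))

  ∈-ancestors⁻ : u ∈ ancestors v → u ∈ₗ vertices (root-path v)
  ∈-ancestors⁻ {v = v} = ∈-tabulate⁻ (_∈ₗ? vertices (root-path v))

  child⇒Adj : w ∈ children v → Adj v w
  child⇒Adj {v = v} w∈ = ∈-neighbours⁻ (proj₁ (x∈p∩q⁻ (neighbours v) (∁ (ancestors v)) w∈))

  -- Since `w` is not on the root path of `v`, prepending it gives a path again.
  depth-child : w ∈ children v → depth w ≡ suc (depth v)
  depth-child {w} {v} w∈ with x∈p∩q⁻ (neighbours v) (∁ (ancestors v)) w∈
  ... | w∈N , w∈∁ = depth≡length (Adj-sym (∈-neighbours⁻ w∈N) ◅ root-path v)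
    (¬Any⇒All¬ _ (x∈∁p⇒x∉p w∈∁ ∘ ∈-ancestors⁺) ∷ root-path-unique v)

  -- By `neighbour-on-path`, `w` is the second vertex of the root path of `v`, and what follows is a
  -- path from `w` to the root.
  depth-parent : Adj v w → w ∈ ancestors v → depth v ≡ suc (depth w)
  depth-parent {v} {w} e w∈ = go (root-path v) (root-path-unique v) (∈-ancestors⁻ w∈)
    where
    go : (q : Walk v root) → Unique (vertices q) → w ∈ₗ vertices q → length q ≡ suc (depth w)
    go ε       _    (here w≡v) = contradiction (sym w≡v) (Adj⇒≢ e)
    go (f ◅ q) uniq@(_ ∷ uniq′) w∈q with neighbour-on-path acyclic f q uniq e w∈q
    ... | refl = cong suc (sym (depth≡length q uniq′))

  child-or-parent : Adj v w → w ∈ children v ⊎ w ∈ ancestors v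
  child-or-parent {v} {w} e with w ∈? ancestors v
  ... | yes w∈ = inj₂ w∈
  ... | no  w∉ = inj₁ (x∈p∩q⁺ (∈-neighbours⁺ e , x∉p⇒x∈∁p w∉))

  depth-Lipschitz : Adj v w → depth w ≤ suc (depth v)
  depth-Lipschitz {v} {w} e with child-or-parent e
  ... | inj₁ w∈ = ≤-reflexive (depth-child w∈)
  ... | inj₂ w∈ = ≤-trans (n≤1+n _) (≤-trans (≤-reflexive (sym (depth-parent e w∈))) (n≤1+n _))

  depth≤length : (q : Walk u v) → depth v ≤ length q + depth u
  depth≤length ε = ≤-refl
  depth≤length {u} {v} (_◅_ {j = w} e q) = begin
    depth v                  ≤⟨ depth≤length q ⟩
    length q + depth w       ≤⟨ +-monoʳ-≤ (length q) (depth-Lipschitz e) ⟩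
    length q + suc (depth u) ≡⟨ +-suc (length q) (depth u) ⟩
    suc (length q + depth u) ∎
    where open ≤-Reasoning

  depth-root : depth root ≡ 0
  depth-root = depth≡length ε ([] ∷ [])

  -- `depth` comes from a path and `Distance` from all walks. The shortest walk of length `n` bounds
  -- the depth from above by `depth≤length`; its minimality against the reversed root path gives the
  -- other inequality.
  depth-leaf : Leaf v → depth v ≡ n
  depth-leaf {v} leaf with root-distance v leaf
  ... | (q , length≡n) , shortest = ≤-antisym
    (subst (depth v ≤_) (trans (cong (length q +_) depth-root) (trans (+-identityʳ _) length≡n)) (depth≤length q))
    (subst (n ≤_) (length-reverse (root-path v)) (shortest (reverse Adj-sym (root-path v))))

  -- The root has degree `k` and no parent; any other inner vertex has degree `suc k` and exactly
  -- one parent, the second vertex of its root path.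
  ∣children∣ : ¬ Leaf v → ∣ children v ∣ ≡ k
  ∣children∣ {v} ¬leaf = go (root-path v) (root-path-unique v) ∈-ancestors⁺ ∈-ancestors⁻
    where
    parents : Subset order
    parents = neighbours v ∩ ancestors v

    split : degree v ≡ ∣ parents ∣ + ∣ children v ∣
    split = ∣p∣≡∣p∩q∣+∣p∩∁q∣ (neighbours v) (ancestors v)

    -- Matching on `q` does not refine `ancestors v`, which is built from `root-path v`; the two
    -- inclusions carry the link between them.
    go : (q : Walk v root) → Unique (vertices q) →
         (∀ {u} → u ∈ₗ vertices q → u ∈ ancestors v) → (∀ {u} → u ∈ ancestors v → u ∈ₗ vertices q) →
         ∣ children v ∣ ≡ k
    go ε _ _ on-path = trans (trans (cong (_+ ∣ children v ∣) (sym ∣parents∣≡0)) (sym split)) root-degree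
      where
      ∣parents∣≡0 : ∣ parents ∣ ≡ 0
      ∣parents∣≡0 = empty⇒∣p∣≡0 λ x x∈ → not-parent (x∈p∩q⁻ (neighbours v) (ancestors v) x∈)
        where
        not-parent : ∀ {x} → x ∈ neighbours v × x ∈ ancestors v → ⊥
        not-parent (x∈N , x∈A) with on-path x∈A
        ... | here x≡v = Adj⇒≢ (∈-neighbours⁻ x∈N) (sym x≡v)
    go (_◅_ {j = a} e q) uniq@(v∉q ∷ _) on-path⁺ on-path =
      suc-injective (trans (trans (cong (_+ ∣ children v ∣) (sym ∣parents∣≡1)) (sym split)) degree≡1+k)
      where
      degree≡1+k : degree v ≡ suc k
      degree≡1+k = internal-degree v ¬leaf λ v≡root →
        All¬⇒¬Any v∉q (subst (_∈ₗ vertices q) (sym v≡root) (end∈ q))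

      is-parent : ∀ {x} → x ∈ parents → x ≡ a
      is-parent x∈ with x∈p∩q⁻ (neighbours v) (ancestors v) x∈
      ... | x∈N , x∈A = neighbour-on-path acyclic e q uniq (∈-neighbours⁻ x∈N) (on-path x∈A)

      ∣parents∣≡1 : ∣ parents ∣ ≡ 1
      ∣parents∣≡1 = ≤-antisym
        (subsingleton⇒∣p∣≤1 λ x∈ y∈ → trans (is-parent x∈) (sym (is-parent y∈)))
        (x∈p⇒1≤∣p∣ (x∈p∩q⁺ (∈-neighbours⁺ e , on-path⁺ (there (start∈ q)))))

  two-children : ¬ Leaf v → ∃[ x ] ∃[ y ] x ∈ children v × y ∈ children v × y ≢ x
  two-children {v} ¬leaf = _ , _ , x∈ , proj₁ (proj₂ y) , proj₂ (proj₂ y)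
    where
    2≤ : 2 ≤ ∣ children v ∣
    2≤ = subst (2 ≤_) (sym (∣children∣ ¬leaf)) 2≤k
    x∈ = proj₂ (1≤∣p∣⇒nonempty (≤-trans (s≤s z≤n) 2≤))
    y  = 2≤∣p∣⇒∃≢ 2≤ (proj₁ (1≤∣p∣⇒nonempty (≤-trans (s≤s z≤n) 2≤)))

  -- A vertex of maximal depth has no children, hence is a leaf.
  depth≤n : ∀ v → depth v ≤ n
  depth≤n v = ≤-trans (deepest-maximal v) (≤-reflexive (depth-leaf deepest-leaf))
    where
    deepest : Vertex
    deepest = argmax depth root (allFin order)

    deepest-maximal : ∀ v → depth v ≤ depth deepest
    deepest-maximal v = All.lookup (f[xs]≤f[argmax] root (allFin order)) (∈-allFin v)

    deepest-leaf : Leaf deepest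
    deepest-leaf with leaf? deepest
    ... | yes leaf = leaf
    ... | no ¬leaf with two-children ¬leaf
    ...   | x , _ , x∈ , _ = contradiction (deepest-maximal x) (<⇒≱ (≤-reflexive (sym (depth-child x∈))))

  -- A non-leaf at depth `n` would have a child at depth `suc n`.
  depth≡n⇒leaf : depth v ≡ n → Leaf v
  depth≡n⇒leaf {v} depth≡n with leaf? v
  ... | yes leaf = leaf
  ... | no ¬leaf with two-children ¬leaf
  ...   | x , _ , x∈ , _ = contradiction (depth≤n x)
    (<⇒≱ (≤-reflexive (trans (cong suc (sym depth≡n)) (sym (depth-child x∈)))))

  -- Otherwise `ℓ` would be the parent of `p`, putting `p` at depth `suc n`.
  leaf-neighbour-child : Leaf ℓ → Adj p ℓ → ℓ ∈ children p
  leaf-neighbour-child {ℓ} {p} leaf e with child-or-parent e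
  ... | inj₁ ℓ∈ = ℓ∈
  ... | inj₂ ℓ∈ = contradiction (depth≤n p)
    (<⇒≱ (≤-reflexive (trans (cong suc (sym (depth-leaf leaf))) (sym (depth-parent e ℓ∈)))))

  -- Leaves grouped by their parents.

  leaf-neighbours : Vertex → Subset order
  leaf-neighbours p = leaves ∩ neighbours p

  ∈-leaf-neighbours⁺ : Leaf ℓ → Adj p ℓ → ℓ ∈ leaf-neighbours p
  ∈-leaf-neighbours⁺ leaf e = x∈p∩q⁺ (∈-leaves⁺ leaf , ∈-neighbours⁺ e)

  ∈-leaf-neighbours⁻ : ℓ ∈ leaf-neighbours p → Leaf ℓ × Adj p ℓ
  ∈-leaf-neighbours⁻ {p = p} ℓ∈ with x∈p∩q⁻ leaves (neighbours p) ℓ∈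
  ... | ℓ∈L , ℓ∈N = ∈-leaves⁻ ℓ∈L , ∈-neighbours⁻ ℓ∈N

  -- One leaf child places `p` just above depth `n`, so all its children have depth `n` and are
  -- leaves too.
  leaf-neighbours≡children : Leaf ℓ → Adj p ℓ → leaf-neighbours p ≡ children p
  leaf-neighbours≡children {ℓ} {p} leaf e = ⊆-antisym
    (λ w∈ → let (w-leaf , f) = ∈-leaf-neighbours⁻ w∈ in leaf-neighbour-child w-leaf f)
    (λ w∈ → ∈-leaf-neighbours⁺ (depth≡n⇒leaf (trans (depth-child w∈) 1+depth≡n)) (child⇒Adj w∈))
    where
    1+depth≡n : suc (depth p) ≡ n
    1+depth≡n = trans (sym (depth-child (leaf-neighbour-child leaf e))) (depth-leaf leaf)

  ∣leaf-neighbours∣ : Leaf ℓ → Adj p ℓ → ∣ leaf-neighbours p ∣ ≡ k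
  ∣leaf-neighbours∣ {ℓ} {p} leaf e = trans (cong ∣_∣ (leaf-neighbours≡children leaf e)) (∣children∣ ¬leaf)
    where
    -- Two adjacent leaves would both have depth `n`, although one is a child of the other.
    ¬leaf : ¬ Leaf p
    ¬leaf p-leaf = contradiction
      (trans (sym (depth-leaf leaf))
        (trans (depth-child (leaf-neighbour-child leaf e)) (cong suc (depth-leaf p-leaf))))
      (<⇒≢ (n<1+n n))

  leaf-parents : Subset order
  leaf-parents = tabulate (does ∘ (nonempty? ∘ leaf-neighbours))

  ∈-leaf-parents⁺ : Nonempty (leaf-neighbours p) → p ∈ leaf-parents
  ∈-leaf-parents⁺ = ∈-tabulate⁺ (nonempty? ∘ leaf-neighbours)

  ∈-leaf-parents⁻ : p ∈ leaf-parents → Nonempty (leaf-neighbours p)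
  ∈-leaf-parents⁻ = ∈-tabulate⁻ (nonempty? ∘ leaf-neighbours)

  module _ {A : Subset order} (A⊆leaves : A ⊆ leaves) where

    -- A leaf has exactly one neighbour, so it is counted at exactly one `p`.
    count-by-parent : ∣ A ∣ ≡ sum (λ p → ∣ A ∩ neighbours p ∣)
    count-by-parent =
      double-counting A neighbours neighbours lookup-neighbours-sym (∈-leaves⁻ ∘ A⊆leaves)

    no-leaf-neighbours : p ∉ leaf-parents → ∣ A ∩ neighbours p ∣ ≡ 0
    no-leaf-neighbours {p} p∉ = empty⇒∣p∣≡0 λ x x∈ → let (x∈A , x∈N) = x∈p∩q⁻ A (neighbours p) x∈ in
      p∉ (∈-leaf-parents⁺ (x , x∈p∩q⁺ (A⊆leaves x∈A , x∈N)))

  ∣leaves∣≡k*∣leaf-parents∣ : ∣ leaves ∣ ≡ k * ∣ leaf-parents ∣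
  ∣leaves∣≡k*∣leaf-parents∣ = trans (count-by-parent id)
    (sum-const-on leaf-parents k _ on (no-leaf-neighbours id))
    where
    on : ∀ {p} → p ∈ leaf-parents → ∣ leaf-neighbours p ∣ ≡ k
    on p∈ with ∈-leaf-parents⁻ p∈
    ... | ℓ , ℓ∈ with ∈-leaf-neighbours⁻ ℓ∈
    ...   | leaf , e = ∣leaf-neighbours∣ leaf e

  -- Lower bound: swapping sibling leaves.

  swap-siblings-preserves : ∀ {i j} → Leaf i → Leaf j → Adj p i → Adj p j →
                            Adj u v → Adj (transpose i j ⟨$⟩ʳ u) (transpose i j ⟨$⟩ʳ v)
  swap-siblings-preserves {p} {u} {v} {i} {j} i-leaf j-leaf p~i p~j e
    = go (u ≟ᶠ i) (u ≟ᶠ j) (v ≟ᶠ i) (v ≟ᶠ j)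
    where
    τ : Vertex → Vertex
    τ = transpose i j ⟨$⟩ʳ_

    τp≡p : τ p ≡ p
    τp≡p = transpose-other i j (Adj⇒≢ p~i) (Adj⇒≢ p~j)

    p~τi : Adj (τ p) (τ i)
    p~τi = subst₂ Adj (sym τp≡p) (sym (transpose-left i j)) p~j

    p~τj : Adj (τ p) (τ j)
    p~τj = subst₂ Adj (sym τp≡p) (sym (transpose-right i j)) p~i

    -- The only edge at a leaf below `p` is the one to `p`, so an edge meeting `i` or `j` is an edge
    -- from `p`, and `τ` exchanges those two edges.
    at-leaf : ∀ {ℓ w} → Leaf ℓ → Adj p ℓ → Adj (τ p) (τ ℓ) → Adj w ℓ → Adj (τ w) (τ ℓ)
    at-leaf leaf p~ℓ p~τℓ e =
      subst (λ w → Adj (τ w) _) (leaf-unique-neighbour leaf (Adj-sym p~ℓ) (Adj-sym e)) p~τℓ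

    go : Dec (u ≡ i) → Dec (u ≡ j) → Dec (v ≡ i) → Dec (v ≡ j) → Adj (τ u) (τ v)
    go (yes refl) _ _ _ = Adj-sym (at-leaf i-leaf p~i p~τi (Adj-sym e))
    go _ (yes refl) _ _ = Adj-sym (at-leaf j-leaf p~j p~τj (Adj-sym e))
    go _ _ (yes refl) _ = at-leaf i-leaf p~i p~τi e
    go _ _ _ (yes refl) = at-leaf j-leaf p~j p~τj e
    go (no u≢i) (no u≢j) (no v≢i) (no v≢j) =
      subst₂ Adj (sym (transpose-other i j u≢i u≢j)) (sym (transpose-other i j v≢i v≢j)) e

  swap-siblings-automorphism : ∀ {i j} → Leaf i → Leaf j → Adj p i → Adj p j →
                               IsAutomorphism (transpose i j)
  swap-siblings-automorphism {i = i} {j} i-leaf j-leaf p~i p~j u v = mk⇔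
    (swap-siblings-preserves i-leaf j-leaf p~i p~j)
    -- Backwards, the same lemma is applied to `transpose j i`, the inverse of `transpose i j`.
    (subst₂ Adj (inverseˡ (transpose i j)) (inverseˡ (transpose i j)) ∘
      swap-siblings-preserves j-leaf i-leaf p~j p~i)

  ∣leaves∖fixing∣ : ∀ {S} → IsFixingSet S → ∣ leaves ∩ ∁ S ∣ ≤ ∣ leaf-parents ∣
  ∣leaves∖fixing∣ {S} fixing = subst (_≤ ∣ leaf-parents ∣) (sym (count-by-parent ⊆leaves))
    (sum≤∣p∣ leaf-parents _ (λ p → subsingleton⇒∣p∣≤1 unmoved-unique) (no-leaf-neighbours ⊆leaves))
    where
    ⊆leaves : leaves ∩ ∁ S ⊆ leaves
    ⊆leaves = p∩q⊆p leaves (∁ S)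

    unfold : ∀ {i} → i ∈ (leaves ∩ ∁ S) ∩ neighbours p → Leaf i × i ∉ S × Adj p i
    unfold {p} i∈ with x∈p∩q⁻ (leaves ∩ ∁ S) (neighbours p) i∈
    ... | i∈L∖S , i∈N with x∈p∩q⁻ leaves (∁ S) i∈L∖S
    ...   | i∈L , i∈∁S = ∈-leaves⁻ i∈L , x∈∁p⇒x∉p i∈∁S , ∈-neighbours⁻ i∈N

    unmoved-unique : ∀ {i j} → i ∈ (leaves ∩ ∁ S) ∩ neighbours p → j ∈ (leaves ∩ ∁ S) ∩ neighbours p → i ≡ j
    unmoved-unique {i = i} {j} i∈ j∈ with unfold i∈ | unfold j∈
    -- The swap moves only `i` and `j`, both outside `S`, so it must be trivial, and its value at
    -- `i` is both `i` and `j`.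
    ... | i-leaf , i∉S , p~i | j-leaf , j∉S , p~j = trans
      (sym (fixing (transpose i j) (swap-siblings-automorphism i-leaf j-leaf p~i p~j)
        (λ x x∈S → transpose-other i j (λ { refl → i∉S x∈S }) (λ { refl → j∉S x∈S })) i))
      (transpose-left i j)

  -- A distinguished leaf below each leaf parent.

  heir : Vertex → Vertex
  heir p with nonempty? (leaf-neighbours p)
  ... | yes (ℓ , _) = ℓ
  -- A dummy value. It never enters `heirs`, because `is-heir?` demands adjacency to `p` and `Adj`
  -- is irreflexive.
  ... | no  _       = p

  heir∈ : Nonempty (leaf-neighbours p) → heir p ∈ leaf-neighbours p
  heir∈ {p} ne with nonempty? (leaf-neighbours p)
  ... | yes (_ , ℓ∈) = ℓ∈
  ... | no  ¬ne      = contradiction ne ¬ne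

  is-heir? : Decidable (λ ℓ → ∃[ p ] Adj p ℓ × heir p ≡ ℓ)
  is-heir? ℓ = any? λ p → adj? p ℓ ×-dec heir p ≟ᶠ ℓ

  heirs : Subset order
  heirs = tabulate (does ∘ is-heir?)

  -- The vertex witnessing `ℓ ∈ heirs` is a neighbour of the leaf `ℓ`, hence equal to `p`.
  heir-of-parent : Leaf ℓ → Adj p ℓ → ℓ ∈ heirs → ℓ ≡ heir p
  heir-of-parent leaf e ℓ∈ with ∈-tabulate⁻ is-heir? ℓ∈
  ... | p′ , e′ , refl = cong heir (leaf-unique-neighbour leaf (Adj-sym e′) (Adj-sym e))

  ∣leaves∩heirs∣ : ∣ leaves ∩ heirs ∣ ≡ ∣ leaf-parents ∣
  ∣leaves∩heirs∣ = trans (count-by-parent ⊆leaves)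
    (trans (sum-const-on leaf-parents 1 _ on (no-leaf-neighbours ⊆leaves)) (*-identityˡ _))
    where
    ⊆leaves : leaves ∩ heirs ⊆ leaves
    ⊆leaves = p∩q⊆p leaves heirs

    is-heir : ∀ {x} → x ∈ (leaves ∩ heirs) ∩ neighbours p → x ≡ heir p
    is-heir {p} x∈ with x∈p∩q⁻ (leaves ∩ heirs) (neighbours p) x∈
    ... | x∈LH , x∈N with x∈p∩q⁻ leaves heirs x∈LH
    ...   | x∈L , x∈H = heir-of-parent (∈-leaves⁻ x∈L) (∈-neighbours⁻ x∈N) x∈H

    on : p ∈ leaf-parents → ∣ (leaves ∩ heirs) ∩ neighbours p ∣ ≡ 1
    on {p} p∈ with ∈-leaf-neighbours⁻ (heir∈ (∈-leaf-parents⁻ p∈))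
    ... | leaf , e = ≤-antisym
      (subsingleton⇒∣p∣≤1 λ x∈ y∈ → trans (is-heir x∈) (sym (is-heir y∈)))
      (x∈p⇒1≤∣p∣ (x∈p∩q⁺ (x∈p∩q⁺ (∈-leaves⁺ leaf , ∈-tabulate⁺ is-heir? (p , e , refl)) , ∈-neighbours⁺ e)))

  -- Upper bound: automorphisms fixing all leaves but the heirs.

  module _ (φ : Permutation′ order) (auto : IsAutomorphism φ) where

    preserves : Adj u v → Adj (φ ⟨$⟩ʳ u) (φ ⟨$⟩ʳ v)
    preserves {u} {v} = Equivalence.to (auto u v)

    -- A non-leaf image would have two distinct children, whose preimages would be two distinct
    -- neighbours of the leaf `v`.
    preserves-leaf : Leaf v → Leaf (φ ⟨$⟩ʳ v)
    preserves-leaf {v} leaf with leaf? (φ ⟨$⟩ʳ v)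
    ... | yes φv-leaf = φv-leaf
    ... | no ¬leaf with two-children ¬leaf
    ...   | x , y , x∈ , y∈ , y≢x = contradiction
      (permutation-injective (flip φ) (leaf-unique-neighbour leaf (pull-back y∈) (pull-back x∈)))
      y≢x
      where
      pull-back : ∀ {w} → w ∈ children (φ ⟨$⟩ʳ v) → Adj v (φ ⟨$⟩ˡ w)
      pull-back {w} w∈ = Equivalence.from (auto v (φ ⟨$⟩ˡ w))
        (subst (Adj (φ ⟨$⟩ʳ v)) (sym (inverseʳ φ)) (child⇒Adj w∈))

    -- Two fixed children c, c′ of a moved v would give the 4-cycle v c (φ v) c′.
    fixed-leaves⇒fixed : (∀ {ℓ} → Leaf ℓ → φ ⟨$⟩ʳ ℓ ≡ ℓ) → ∀ v → φ ⟨$⟩ʳ v ≡ v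
    fixed-leaves⇒fixed fixes-leaf v = go (n ∸ depth v) v (m+[n∸m]≡n (depth≤n v))
      where
      -- The height `h` drops by one from a vertex to its child; at height zero the depth is `n`,
      -- which only leaves attain.
      go : ∀ h v → depth v + h ≡ n → φ ⟨$⟩ʳ v ≡ v
      go zero    v eq = fixes-leaf (depth≡n⇒leaf (trans (sym (+-identityʳ _)) eq))
      go (suc h) v eq with leaf? v | φ ⟨$⟩ʳ v ≟ᶠ v
      ... | yes leaf | _        = fixes-leaf leaf
      ... | no  _    | yes φv≡v = φv≡v
      ... | no ¬leaf | no  φv≢v with two-children ¬leaf
      ...   | x , y , x∈ , y∈ , y≢x = contradiction
        (neighbours-separated acyclic (child⇒Adj y∈) (child⇒Adj x∈) (Adj-sym (φv~ y∈) ◅ φv~ x∈ ◅ ε)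
          (Adj⇒≢ (child⇒Adj y∈) ∷ ≢-sym φv≢v ∷ Adj⇒≢ (child⇒Adj x∈) ∷ []))
        y≢x
        where
        φv~ : ∀ {w} → w ∈ children v → Adj (φ ⟨$⟩ʳ v) w
        φv~ {w} w∈ = subst (Adj (φ ⟨$⟩ʳ v))
          (go h w (trans (cong (_+ h) (depth-child w∈)) (trans (sym (+-suc (depth v) h)) eq)))
          (preserves (child⇒Adj w∈))

  leaves∖heirs-fixing : IsFixingSet (leaves ∩ ∁ heirs)
  leaves∖heirs-fixing φ auto fixes = fixed-leaves⇒fixed φ auto fixes-leaf
    where
    fixes-non-heir : Leaf ℓ → ℓ ∉ heirs → φ ⟨$⟩ʳ ℓ ≡ ℓ
    fixes-non-heir leaf ℓ∉ = fixes _ (x∈p∩q⁺ (∈-leaves⁺ leaf , x∉p⇒x∈∁p ℓ∉))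

    -- As `k` is at least 2, some leaf `ℓ′` below `p` is not the heir and is therefore fixed. Then
    -- `φ ⟨$⟩ʳ p` is adjacent to `ℓ′`, whose only neighbour is `p`.
    fixes-leaf-parent : Leaf ℓ → Adj p ℓ → φ ⟨$⟩ʳ p ≡ p
    fixes-leaf-parent {p = p} leaf e
      with 2≤∣p∣⇒∃≢ (subst (2 ≤_) (sym (∣leaf-neighbours∣ leaf e)) 2≤k) (heir p)
    ... | ℓ′ , ℓ′∈ , ℓ′≢heir with ∈-leaf-neighbours⁻ ℓ′∈
    ...   | leaf′ , e′ = leaf-unique-neighbour leaf′
      (Adj-sym (subst (Adj (φ ⟨$⟩ʳ p))
        (fixes-non-heir leaf′ (ℓ′≢heir ∘ heir-of-parent leaf′ e′)) (preserves φ auto e′)))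
      (Adj-sym e′)

    fixes-leaf : Leaf ℓ → φ ⟨$⟩ʳ ℓ ≡ ℓ
    fixes-leaf {ℓ} leaf with ℓ ∈? heirs | φ ⟨$⟩ʳ ℓ ∈? heirs
    ... | no ℓ∉  | _      = fixes-non-heir leaf ℓ∉
    -- Here the image of `ℓ` is itself a fixed leaf, so `ℓ` and its image have the same image.
    ... | yes ℓ∈ | no φℓ∉ = permutation-injective φ (fixes-non-heir (preserves-leaf φ auto leaf) φℓ∉)
    -- Since the parent `p` is fixed, `ℓ` and its image are both the heir of `p`.
    ... | yes ℓ∈ | yes φℓ∈ with ∈-tabulate⁻ is-heir? ℓ∈
    ...   | p , e , heir≡ℓ = trans (heir-of-parent (preserves-leaf φ auto leaf) p~φℓ φℓ∈) heir≡ℓ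
      where
      p~φℓ : Adj p (φ ⟨$⟩ʳ ℓ)
      p~φℓ = subst (λ x → Adj x (φ ⟨$⟩ʳ ℓ)) (fixes-leaf-parent leaf e) (preserves φ auto e)

-- The fixing number from the two bounds.

proposition1 : (k n : ℕ) → 2 ≤ k → 1 ≤ n →
    (G : Graph) → IsPerfectTree k n G →
    Graph.FixingNumber G ((k ∸ 1) * k ^ (n ∸ 1))
proposition1 k@(suc j) (suc m) 2≤k _ G T =
  -- Both bounds are shown with `k ^ m`, the number of leaf parents, added to each side:
  -- `k ^ m + j * k ^ m` is `k ^ suc m` by definition, which is the leaf count.
  (leaves ∩ ∁ heirs , leaves∖heirs-fixing , +-cancelˡ-≡ (k ^ m) _ _ upper) ,
  λ S fixing → +-cancelˡ-≤ (k ^ m) _ _ (lower S fixing)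
  where
  open Graph G
  open IsPerfectTree T
  open PerfectTree 2≤k G T

  ∣leaf-parents∣ : ∣ leaf-parents ∣ ≡ k ^ m
  ∣leaf-parents∣ = *-cancelˡ-≡ _ _ k (trans (sym ∣leaves∣≡k*∣leaf-parents∣) leaf-count)

  upper : k ^ m + ∣ leaves ∩ ∁ heirs ∣ ≡ k ^ m + j * k ^ m
  upper = begin
    k ^ m + ∣ leaves ∩ ∁ heirs ∣              ≡⟨ cong (_+ ∣ leaves ∩ ∁ heirs ∣) (trans ∣leaves∩heirs∣ ∣leaf-parents∣) ⟨
    ∣ leaves ∩ heirs ∣ + ∣ leaves ∩ ∁ heirs ∣ ≡⟨ ∣p∣≡∣p∩q∣+∣p∩∁q∣ leaves heirs ⟨
    ∣ leaves ∣                                ≡⟨ leaf-count ⟩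
    k ^ m + j * k ^ m                         ∎
    where open ≡-Reasoning

  lower : ∀ S → IsFixingSet S → k ^ m + j * k ^ m ≤ k ^ m + ∣ S ∣
  lower S fixing = begin
    k ^ m + j * k ^ m                 ≡⟨ leaf-count ⟨
    ∣ leaves ∣                        ≡⟨ ∣p∣≡∣p∩q∣+∣p∩∁q∣ leaves S ⟩
    ∣ leaves ∩ S ∣ + ∣ leaves ∩ ∁ S ∣ ≤⟨ +-mono-≤ (∣p∩q∣≤∣q∣ leaves S) (∣leaves∖fixing∣ fixing) ⟩
    ∣ S ∣ + ∣ leaf-parents ∣          ≡⟨ cong (∣ S ∣ +_) ∣leaf-parents∣ ⟩
    ∣ S ∣ + k ^ m                     ≡⟨ +-comm ∣ S ∣ (k ^ m) ⟩
    k ^ m + ∣ S ∣                     ∎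
    where open ≤-Reasoning
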